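{- Every positive integer can be expressed as a sum of distinct, non-consecutive Fibonacci numbers. Further, for every $n\ge 1$ and every integer $k\ge 0$, the probability that an integer $N$ chosen uniformly at random from $[F_n,F_{n+1})$ has exactly $k+1$ summands in its Zeckendorf decomposition is $$p_n(k)=\frac{\binom{n-1-k}{k}}{F_{n-1}}.$$
   Context: The Fibonacci numbers are indexed by $F_1=1$, $F_2=2$, and $F_n=F_{n-1}+F_{n-2}$ for $n\ge 3$ (so $F_3=3$, $F_4=5$), with $F_0=1$ by extending the recurrence backwards; the interval $[F_n,F_{n+1})$ contains exactly $F_{n+1}-F_n=F_{n-1}$ integers. The Zeckendorf decomposition of $N$ is its representation $N=F_{m_1}+\cdots+F_{m_r}$ with indices $m_j\ge 1$ and $m_{j+1}\ge m_j+2$ for all $j$ (such a representation is unique); its number of summands is $r$. The binomial coefficient $\binom{n-1-k}{k}$ is taken to be $0$ when $k>\lfloor (n-1)/2\rfloor$. -}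

module Defs where

open import Data.Integer.Base using (+_)
open import Data.List.Base using (List; []; _∷_; length; map; filter; upTo)
open import Data.List.Properties using (length-map; length-upTo)
open import Data.List.Relation.Unary.All using (All; []; _∷_; all?)
open import Data.List.Relation.Unary.Linked using (Linked; linked?)
open import Data.Nat.Base hiding (_/_)
open import Data.Nat.ListAction using (sum)
open import Data.Nat.Properties
open import Data.Product.Base using (∃; _×_; _,_)
open import Data.Rational.Base using (ℚ; _/_)
open import Level using (Level)
open import Relation.Binary.PropositionalEquality using (_≡_; refl; sym; trans; cong; subst)
open import Relation.Nullary.Decidable using (Dec; map′; _×-dec_)
open import Relation.Unary using (Pred; Decidable)

private
  variable
    a p : Level
    A : Set a

-- Indexed so that F 1 = 1, F 2 = 2, F 3 = 3, F 4 = 5; F 0 = 1 is the backward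
-- extension of the recurrence.
F : ℕ → ℕ
F 0             = 1
F 1             = 1
F (suc (suc n)) = F (suc n) + F n

F>0 : ∀ n → 0 < F n
F>0 0             = ≤-refl
F>0 1             = ≤-refl
F>0 (suc (suc n)) = ≤-trans (F>0 (suc n)) (m≤m+n _ _)

F-nonZero : ∀ n → NonZero (F n)
F-nonZero n = >-nonZero (F>0 n)

-- The list holds the indices m₁ , … , mᵣ in increasing order. Indices start at 1
-- because F 0 = F 1.
record IsZeckendorf (N : ℕ) (ms : List ℕ) : Set where
  constructor mkIsZeckendorf
  field
    positive       : All (1 ≤_) ms
    nonConsecutive : Linked (λ i j → i + 2 ≤ j) ms
    total          : N ≡ sum (map F ms)

-- Zeckendorf decompositions are unique, so this says that "the" decomposition
-- of N has r summands.
HasSummands : ℕ → ℕ → Set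
HasSummands r N = ∃ λ ms → IsZeckendorf N ms × length ms ≡ r

[_,_⟩ : ℕ → ℕ → List ℕ
[ a , b ⟩ = map (λ i → a + i) (upTo (b ∸ a))

-- Uniform probability on the entries of a nonempty list without repetitions.
Pr : {P : Pred A p} (xs : List A) .{{_ : NonZero (length xs)}} → Decidable P → ℚ
Pr xs P? = (+ length (filter P? xs)) / length xs

length-interval : ∀ n .{{_ : NonZero n}} → length [ F n , F (suc n) ⟩ ≡ F (n ∸ 1)
length-interval (suc n) =
  trans (length-map _ (upTo (F (suc n) + F n ∸ F (suc n))))
    (trans (length-upTo _) (m+n∸m≡n (F (suc n)) (F n)))

interval-nonZero : ∀ n .{{_ : NonZero n}} → NonZero (length [ F n , F (suc n) ⟩)
interval-nonZero n = subst NonZero (sym (length-interval n)) (F-nonZero (n ∸ 1))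

isZeckendorf? : ∀ N → Decidable (IsZeckendorf N)
isZeckendorf? N ms =
  map′ (λ (p , c , t) → mkIsZeckendorf p c t)
       (λ (mkIsZeckendorf p c t) → p , c , t)
       (all? (1 ≤?_) ms ×-dec linked? (λ i j → i + 2 ≤? j) ms ×-dec N ≟ sum (map F ms))

private
  n≤F[n] : ∀ n → n ≤ F n
  n≤F[n] 0             = z≤n
  n≤F[n] 1             = ≤-refl
  n≤F[n] (suc (suc n)) =
    subst (_≤ F (suc n) + F n) (+-comm (suc n) 1)
      (+-mono-≤ (n≤F[n] (suc n)) (F>0 n))

  indices-bounded : ∀ ms {N} → sum (map F ms) ≤ N → All (_< suc N) ms
  indices-bounded []       _   = []
  indices-bounded (m ∷ ms) s≤N =
    s≤s (≤-trans (n≤F[n] m) (m+n≤o⇒m≤o (F m) s≤N)) ∷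
    indices-bounded ms (m+n≤o⇒n≤o (F m) s≤N)

  anyBoundedList? : ∀ {P : Pred (List ℕ) p} → Decidable P → ∀ b r →
                    Dec (∃ λ ms → All (_< b) ms × P ms × length ms ≡ r)
  anyBoundedList? P? b zero =
    map′ (λ p → [] , [] , p , refl) (λ { ([] , _ , p , _) → p }) (P? [])
  anyBoundedList? P? b (suc r) =
    map′ (λ (m , m<b , ms , ms<b , p , eq) → m ∷ ms , m<b ∷ ms<b , p , cong suc eq)
         (λ { (m ∷ ms , m<b ∷ ms<b , p , eq) → m , m<b , ms , ms<b , p , suc-injective eq })
         (anyUpTo? (λ m → anyBoundedList? (λ ms → P? (m ∷ ms)) b r) b)

hasSummands? : ∀ r → Decidable (HasSummands r)
hasSummands? r N =
  map′ (λ (ms , _ , z , eq) → ms , z , eq)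
       (λ (ms , z , eq) → ms , indices-bounded ms (≤-reflexive (sym (IsZeckendorf.total z))) , z , eq)
       (anyBoundedList? (isZeckendorf? N) (suc N) r)

{-# OPTIONS --safe #-}

-- Removing the largest index turns the decompositions with r + 1 summands of
-- the numbers in [F (n + 1), F (n + 2)) into those with r summands of the
-- numbers below F n, because numbers below F n only involve indices below n.
-- Hence the number A m r of integers below F m with r summands satisfies
-- A (m + 2) (r + 1) = A (m + 1) (r + 1) + A m r, which is Pascal's rule for
-- A m r = (m - r) C r.
module Submission where

open import Defs
open import Data.Integer.Base using (+_)
open import Data.List.Base using (List; []; _∷_; [_]; _∷ʳ_; _++_; map; filter; length; upTo; applyUpTo; initLast; _∷ʳ′_)
open import Data.List.Properties using (map-++; length-++; map-upTo; filter-++; filter-none; filter-accept; filter-reject)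
open import Data.List.Relation.Unary.All as All using (All; []; _∷_)
open import Data.List.Relation.Unary.All.Properties using (all-upTo; map⁺; ∷ʳ⁺; ∷ʳ⁻)
open import Data.List.Relation.Unary.Linked using (Linked; []; [-]; _∷_)
open import Data.Nat.Base using (ℕ; zero; suc; _+_; _∸_; _≤_; _<_; z≤n; s≤s; NonZero)
open import Data.Nat.Combinatorics using (_C_; nCk+nC[k+1]≡[n+1]C[k+1]; k>n⇒nCk≡0)
open import Data.Nat.ListAction using (sum)
open import Data.Nat.ListAction.Properties using (sum-++)
open import Data.Nat.Properties
open import Data.Product.Base using (∃; _×_; _,_)
open import Data.Rational.Base using (_/_)
open import Data.Rational.Properties using (/-cong)
open import Data.Sum.Base using (inj₁; inj₂)
open import Function.Base using (_∘_; id)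
open import Function.Bundles using (_⇔_; mk⇔; Equivalence)
open import Level using (Level)
open import Relation.Binary.Core using (Rel)
open import Relation.Binary.Definitions using (Transitive)
open import Relation.Binary.PropositionalEquality using (_≡_; refl; sym; trans; cong; cong₂; subst; module ≡-Reasoning)
open import Relation.Nullary.Decidable using (yes; no)
open import Relation.Nullary.Negation using (¬_; contradiction)
open import Relation.Unary using (Pred; Decidable)

private
  variable
    a b p q ℓ : Level
    A : Set a
    B : Set b

-- Lists: appending a last entry, splitting ranges, transferring counts.

Linked-∷ʳ⁺ : {R : Rel A ℓ} {xs : List A} {y : A} →
             Linked R xs → All (λ x → R x y) xs → Linked R (xs ∷ʳ y)
Linked-∷ʳ⁺ []       _         = [-]
Linked-∷ʳ⁺ [-]      (Rxy ∷ _) = Rxy ∷ [-]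
Linked-∷ʳ⁺ (r ∷ rs) (_ ∷ ps)  = r ∷ Linked-∷ʳ⁺ rs ps

-- Links join neighbours only; transitivity carries the relation to the last entry back to all
-- earlier ones.
Linked-∷ʳ⁻ : {R : Rel A ℓ} → Transitive R → ∀ xs {y} →
             Linked R (xs ∷ʳ y) → Linked R xs × All (λ x → R x y) xs
Linked-∷ʳ⁻ R-trans []           _         = [] , []
Linked-∷ʳ⁻ R-trans (x ∷ [])     (r ∷ [-]) = [-] , r ∷ []
Linked-∷ʳ⁻ R-trans (x ∷ z ∷ xs) (r ∷ rs)
  with rs′ , ps@(p ∷ _) ← Linked-∷ʳ⁻ R-trans (z ∷ xs) rs
  = r ∷ rs′ , R-trans r p ∷ ps

applyUpTo-++ : ∀ (f : ℕ → A) m n →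
               applyUpTo f (m + n) ≡ applyUpTo f m ++ applyUpTo (λ i → f (m + i)) n
applyUpTo-++ f zero    n = refl
applyUpTo-++ f (suc m) n = cong (f 0 ∷_) (applyUpTo-++ (f ∘ suc) m n)

upTo-++-interval : ∀ {m n} → m ≤ n → upTo n ≡ upTo m ++ [ m , n ⟩
upTo-++-interval {m} {n} m≤n = begin
  upTo n                                     ≡⟨ cong upTo (m+[n∸m]≡n m≤n) ⟨
  upTo (m + (n ∸ m))                         ≡⟨ applyUpTo-++ id m (n ∸ m) ⟩
  upTo m ++ applyUpTo (λ i → m + i) (n ∸ m)  ≡⟨ cong (upTo m ++_) (map-upTo (λ i → m + i) (n ∸ m)) ⟨
  upTo m ++ [ m , n ⟩                        ∎
  where open ≡-Reasoning

-- The equivalence is asked for on the entries alone, because `HasSummands-suc` supplies it only for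
-- `N < F n`.
length-filter-map : {P : Pred B p} {Q : Pred A q} (P? : Decidable P) (Q? : Decidable Q)
                    (f : A → B) {xs : List A} → All (λ x → P (f x) ⇔ Q x) xs →
                    length (filter P? (map f xs)) ≡ length (filter Q? xs)
length-filter-map P? Q? f []                       = refl
length-filter-map P? Q? f {x ∷ xs} (Pfx⇔Qx ∷ eqvs) with P? (f x) | Q? x
... | yes _   | yes _  = cong suc (length-filter-map P? Q? f eqvs)
... | no  _   | no  _  = length-filter-map P? Q? f eqvs
... | yes Pfx | no ¬Qx = contradiction (Equivalence.to Pfx⇔Qx Pfx) ¬Qx
... | no ¬Pfx | yes Qx = contradiction (Equivalence.from Pfx⇔Qx Qx) ¬Pfx

-- Growth of `F` and bounds on sums of its values.

F[n]≤F[1+n] : ∀ n → F n ≤ F (suc n)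
F[n]≤F[1+n] zero    = ≤-refl
F[n]≤F[1+n] (suc n) = m≤m+n (F (suc n)) (F n)

F-mono-≤ : ∀ {m n} → m ≤ n → F m ≤ F n
F-mono-≤ {n = zero}  z≤n = ≤-refl
F-mono-≤ {n = suc n} m≤1+n with m≤n⇒m<n∨m≡n m≤1+n
... | inj₁ (s≤s m≤n) = ≤-trans (F-mono-≤ m≤n) (F[n]≤F[1+n] n)
... | inj₂ refl      = ≤-refl

-- Only the strict order is reflected, since `F 0` equals `F 1`.
F-cancel-< : ∀ {m n} → F m < F n → m < n
F-cancel-< Fm<Fn = ≰⇒> λ n≤m → <⇒≱ Fm<Fn (F-mono-≤ n≤m)

-- Places every `N` in an initial range, so that existence can be proved range by range.
n<F[1+n] : ∀ n → n < F (suc n)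
n<F[1+n] zero          = ≤-refl
n<F[1+n] (suc zero)    = ≤-refl
n<F[1+n] (suc (suc n)) =
  subst (_≤ F (suc (suc n)) + F (suc n)) (+-comm (suc (suc n)) 1)
    (+-mono-≤ (n<F[1+n] (suc n)) (F>0 (suc n)))

sum-F-∷ʳ : ∀ ms l → sum (map F (ms ∷ʳ l)) ≡ F l + sum (map F ms)
sum-F-∷ʳ ms l = begin
  sum (map F (ms ∷ʳ l))         ≡⟨ cong sum (map-++ F ms [ l ]) ⟩
  sum (map F ms ++ [ F l ])     ≡⟨ sum-++ (map F ms) [ F l ] ⟩
  sum (map F ms) + (F l + 0)    ≡⟨ cong (λ i → sum (map F ms) + i) (+-identityʳ (F l)) ⟩
  sum (map F ms) + F l          ≡⟨ +-comm (sum (map F ms)) (F l) ⟩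
  F l + sum (map F ms)          ∎
  where open ≡-Reasoning

indices-≤ : ∀ ms → All (λ m → F m ≤ sum (map F ms)) ms
indices-≤ []       = []
indices-≤ (m ∷ ms) = m≤m+n (F m) _ ∷ All.map (m≤n⇒m≤o+n (F m)) (indices-≤ ms)

-- The term F m absorbs the sum from below: F m + F (1 + m) = F (2 + m) is at
-- most the corresponding term for the next index.
sum-F-≤ : ∀ {m ms n} → Linked (λ i j → i + 2 ≤ j) (suc m ∷ ms) → All (_< n) (suc m ∷ ms) →
          F m + sum (map F (suc m ∷ ms)) ≤ F n
sum-F-≤ {m} {[]} {n} _ (1+m<n ∷ _) = begin
  F m + (F (suc m) + 0)  ≡⟨ cong (λ i → F m + i) (+-identityʳ (F (suc m))) ⟩
  F m + F (suc m)        ≡⟨ +-comm (F m) (F (suc m)) ⟩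
  F (2 + m)              ≤⟨ F-mono-≤ 1+m<n ⟩
  F n                    ∎
  where open ≤-Reasoning
sum-F-≤ {m} {zero ∷ ms} (() ∷ _) _
sum-F-≤ {m} {suc j ∷ ms} {n} (s≤s m+2≤j ∷ lnk) (_ ∷ ms<n) = begin
  F m + (F (suc m) + s)  ≡⟨ +-assoc (F m) (F (suc m)) s ⟨
  F m + F (suc m) + s    ≡⟨ cong (_+ s) (+-comm (F m) (F (suc m))) ⟩
  F (2 + m) + s          ≡⟨ cong (λ i → F i + s) (+-comm 2 m) ⟩
  F (m + 2) + s          ≤⟨ +-monoˡ-≤ s (F-mono-≤ m+2≤j) ⟩
  F j + s                ≤⟨ sum-F-≤ lnk ms<n ⟩
  F n                    ∎
  where
  open ≤-Reasoning
  s = sum (map F (suc j ∷ ms))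

-- When the smallest index is `suc m`, the surplus term `F m` in `sum-F-≤` is positive, which makes
-- the bound strict.
indices-<⇒N<F : ∀ {N ms n} → IsZeckendorf N ms → All (_< n) ms → N < F n
indices-<⇒N<F {ms = []}         {n} (mkIsZeckendorf _ _ refl) _ = F>0 n
indices-<⇒N<F {ms = zero ∷ ms}      (mkIsZeckendorf (() ∷ _) _ _) _
indices-<⇒N<F {ms = suc m ∷ ms} {n} (mkIsZeckendorf _ lnk refl) ms<n =
  <-≤-trans (m<n+m _ (F>0 m)) (sum-F-≤ lnk ms<n)

-- Adding and removing the largest index.

gap-trans : Transitive (λ i j → i + 2 ≤ j)
gap-trans {i} i+2≤j j+2≤k = ≤-trans i+2≤j (m+n≤o⇒m≤o _ j+2≤k)

IsZeckendorf-∷ʳ⁺ : ∀ {n N ms} → N < F n → IsZeckendorf N ms →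
                   IsZeckendorf (F (suc n) + N) (ms ∷ʳ suc n)
IsZeckendorf-∷ʳ⁺ {n} {N} {ms} N<Fn (mkIsZeckendorf pos lnk refl) =
  mkIsZeckendorf (∷ʳ⁺ pos (s≤s z≤n)) (Linked-∷ʳ⁺ lnk (All.map gap (indices-≤ ms)))
                 (sym (sum-F-∷ʳ ms (suc n)))
  where
  gap : ∀ {m} → F m ≤ N → m + 2 ≤ suc n
  -- From `F m ≤ N < F n` follows `m < n`, which is already a gap of two below `suc n`.
  gap {m} Fm≤N = subst (_≤ suc n) (+-comm 2 m) (s≤s (F-cancel-< (≤-<-trans Fm≤N N<Fn)))

-- The last index is forced to be `suc n`: a larger one makes the sum at least `F (2 + n)`, a
-- smaller one keeps it below `F (suc n)`.
IsZeckendorf-∷ʳ⁻ : ∀ {n N ms l} → N < F n → IsZeckendorf (F (suc n) + N) (ms ∷ʳ l) →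
                   IsZeckendorf N ms
IsZeckendorf-∷ʳ⁻ {n} {N} {ms} {l} N<Fn z@(mkIsZeckendorf pos lnk tot)
  with pos′ , _ ← ∷ʳ⁻ pos
     | lnk′ , gaps ← Linked-∷ʳ⁻ gap-trans ms lnk
     | _ , Fl≤ ← ∷ʳ⁻ {xs = ms} (indices-≤ (ms ∷ʳ l))
  with m<1+n⇒m<n∨m≡n (F-cancel-< {l} {2 + n}
         (≤-<-trans Fl≤ (subst (_< F (2 + n)) tot (+-monoʳ-< (F (suc n)) N<Fn))))
-- The gaps bound every index by `l`, so all indices would lie below `suc n`.
... | inj₁ l<1+n = contradiction (m≤m+n (F (suc n)) N) (<⇒≱ (indices-<⇒N<F z
        (∷ʳ⁺ (All.map (λ m+2≤l → ≤-<-trans (m+n≤o⇒m≤o _ m+2≤l) l<1+n) gaps) l<1+n)))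
... | inj₂ refl  = mkIsZeckendorf pos′ lnk′
        (+-cancelˡ-≡ (F (suc n)) N _ (trans tot (sum-F-∷ʳ ms (suc n))))

length-∷ʳ : ∀ (xs : List A) x → length (xs ∷ʳ x) ≡ suc (length xs)
length-∷ʳ xs x = trans (length-++ xs) (+-comm (length xs) 1)

HasSummands-suc : ∀ {n N} r → N < F n → HasSummands (suc r) (F (suc n) + N) ⇔ HasSummands r N
HasSummands-suc {n} {N} r N<Fn = mk⇔ to from
  where
  to : HasSummands (suc r) (F (suc n) + N) → HasSummands r N
  to (ms , z , len) with initLast ms
  -- The empty list is excluded by `len`.
  ... | ms′ ∷ʳ′ l =
    ms′ , IsZeckendorf-∷ʳ⁻ {n} N<Fn z , suc-injective (trans (sym (length-∷ʳ ms′ l)) len)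

  from : HasSummands r N → HasSummands (suc r) (F (suc n) + N)
  from (ms , z , len) =
    ms ∷ʳ suc n , IsZeckendorf-∷ʳ⁺ N<Fn z , trans (length-∷ʳ ms (suc n)) (cong suc len)

-- Existence of decompositions.

ZeckendorfBelow : ℕ → Set
ZeckendorfBelow b = ∀ N → N < b → ∃ λ ms → IsZeckendorf N ms

-- The greedy choice: subtracting `F (suc n)` when possible leaves a remainder below `F n`, whose
-- indices are then far enough from `suc n`.
zeckendorf-step : ∀ n → ZeckendorfBelow (F n) → ZeckendorfBelow (F (suc n)) →
                  ZeckendorfBelow (F (2 + n))
zeckendorf-step n below-F[n] below-F[1+n] N N<F with N <? F (suc n)
... | yes N<F′ = below-F[1+n] N N<F′
... | no  N≮F′
  with M , refl ← m≤n⇒∃[o]m+o≡n (≮⇒≥ N≮F′)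
  with M<Fn ← +-cancelˡ-< (F (suc n)) M (F n) N<F
  with ms , z ← below-F[n] M M<Fn
  = ms ∷ʳ suc n , IsZeckendorf-∷ʳ⁺ M<Fn z

zeckendorf-below-F : ∀ n → ZeckendorfBelow (F n)
zeckendorf-below-F 0 0 _ = [] , mkIsZeckendorf [] [] refl
zeckendorf-below-F 1 0 _ = [] , mkIsZeckendorf [] [] refl
zeckendorf-below-F 0 (suc N) (s≤s ())
zeckendorf-below-F 1 (suc N) (s≤s ())
zeckendorf-below-F (suc (suc n)) =
  zeckendorf-step n (zeckendorf-below-F n) (zeckendorf-below-F (suc n))

-- Counting by number of summands.

HasSummands-zero⇒≡0 : ∀ {N} → HasSummands 0 N → N ≡ 0
HasSummands-zero⇒≡0 ([] , z , _) = IsZeckendorf.total z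

¬HasSummands-suc-0 : ∀ r → ¬ HasSummands (suc r) 0
¬HasSummands-suc-0 r (m ∷ ms , mkIsZeckendorf _ _ tot , _) =
  <⇒≢ (≤-trans (F>0 m) (m≤m+n (F m) _)) tot

count : ℕ → List ℕ → ℕ
count r xs = length (filter (hasSummands? r) xs)

count-++ : ∀ r xs ys → count r (xs ++ ys) ≡ count r xs + count r ys
count-++ r xs ys =
  trans (cong length (filter-++ (hasSummands? r) xs ys)) (length-++ (filter (hasSummands? r) xs))

-- The interval is the range below `F n` shifted by `F (suc n)`, and the shift adds exactly one
-- summand.
count-interval-suc : ∀ n r → count (suc r) [ F (suc n) , F (2 + n) ⟩ ≡ count r (upTo (F n))
count-interval-suc n r = begin
  count (suc r) (map (λ i → F (suc n) + i) (upTo (F (2 + n) ∸ F (suc n))))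
    ≡⟨ cong (λ b → count (suc r) (map (λ i → F (suc n) + i) (upTo b))) (m+n∸m≡n (F (suc n)) (F n)) ⟩
  count (suc r) (map (λ i → F (suc n) + i) (upTo (F n)))
    ≡⟨ length-filter-map (hasSummands? (suc r)) (hasSummands? r) (λ i → F (suc n) + i)
         (All.map (HasSummands-suc {n} r) (all-upTo (F n))) ⟩
  count r (upTo (F n)) ∎
  where open ≡-Reasoning

count-interval-zero : ∀ n → count 0 [ F (suc n) , F (2 + n) ⟩ ≡ 0
count-interval-zero n = cong length (filter-none (hasSummands? 0)
  (map⁺ (All.universal ¬empty (upTo (F (2 + n) ∸ F (suc n))))))
  where
  ¬empty : ∀ i → ¬ HasSummands 0 (F (suc n) + i)
  ¬empty i h =
    <⇒≢ (≤-trans (F>0 (suc n)) (m≤m+n (F (suc n)) i)) (sym (HasSummands-zero⇒≡0 h))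

count-split : ∀ n r → count r (upTo (F (2 + n)))
                      ≡ count r (upTo (F (suc n))) + count r [ F (suc n) , F (2 + n) ⟩
count-split n r = trans (cong (count r) (upTo-++-interval (F[n]≤F[1+n] (suc n))))
                        (count-++ r (upTo (F (suc n))) [ F (suc n) , F (2 + n) ⟩)

pascal-diagonal : ∀ m r → (m ∸ r) C suc r + (m ∸ r) C r ≡ (suc m ∸ r) C suc r
pascal-diagonal m r with r ≤? m
... | yes r≤m = begin
  (m ∸ r) C suc r + (m ∸ r) C r ≡⟨ +-comm ((m ∸ r) C suc r) _ ⟩
  (m ∸ r) C r + (m ∸ r) C suc r ≡⟨ nCk+nC[k+1]≡[n+1]C[k+1] (m ∸ r) r ⟩
  suc (m ∸ r) C suc r           ≡⟨ cong (_C suc r) (+-∸-assoc 1 r≤m) ⟨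
  (suc m ∸ r) C suc r           ∎
  where open ≡-Reasoning
-- Here `m < r`, so both truncated differences are 0; as `r` is positive, `0 C r` vanishes as well.
... | no r≰m
  rewrite m≤n⇒m∸n≡0 (<⇒≤ (≰⇒> r≰m)) | m≤n⇒m∸n≡0 (≰⇒> r≰m)
        | k>n⇒nCk≡0 {0} {r} (≤-<-trans z≤n (≰⇒> r≰m)) = refl

-- Both base cases at once: the range below `F 0` and the one below `F 1` contain only 0, whose sole
-- decomposition is empty.
count-[0] : ∀ m r → m ≤ 1 → count r (0 ∷ []) ≡ (m ∸ r) C r
count-[0] m zero    _   = cong length (filter-accept (hasSummands? 0) {0} {[]}
                            ([] , mkIsZeckendorf [] [] refl , refl))
count-[0] m (suc r) m≤1 = begin
  count (suc r) (0 ∷ [])  ≡⟨ cong length (filter-reject (hasSummands? (suc r)) {0} {[]} (¬HasSummands-suc-0 r)) ⟩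
  0                       ≡⟨ cong (_C suc r) (m≤n⇒m∸n≡0 (≤-trans m≤1 (s≤s z≤n))) ⟨
  (m ∸ suc r) C suc r     ∎
  where open ≡-Reasoning

count-below-F : ∀ m r → count r (upTo (F m)) ≡ (m ∸ r) C r
count-below-F 0 r = count-[0] 0 r z≤n
count-below-F 1 r = count-[0] 1 r ≤-refl
-- The interval contributes nothing, and `n C 0` computes to 1 on both sides.
count-below-F (suc (suc m)) zero =
  trans (count-split m 0) (cong₂ _+_ (count-below-F (suc m) 0) (count-interval-zero m))
count-below-F (suc (suc m)) (suc r) = begin
  count (suc r) (upTo (F (2 + m)))
    ≡⟨ count-split m (suc r) ⟩
  count (suc r) (upTo (F (suc m))) + count (suc r) [ F (suc m) , F (2 + m) ⟩
    ≡⟨ cong₂ _+_ (count-below-F (suc m) (suc r))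
                 (trans (count-interval-suc m r) (count-below-F m r)) ⟩
  (m ∸ r) C suc r + (m ∸ r) C r
    ≡⟨ pascal-diagonal m r ⟩
  (suc m ∸ r) C suc r ∎
  where open ≡-Reasoning

theorem2p3 : (∀ N → 1 ≤ N → ∃ λ ms → IsZeckendorf N ms)
    × (∀ n .{{_ : NonZero n}} (k : ℕ) →
    Pr [ F n , F (suc n) ⟩ {{interval-nonZero n}} (hasSummands? (suc k))
    ≡ ((+ ((n ∸ 1 ∸ k) C k)) / F (n ∸ 1)) {{F-nonZero (n ∸ 1)}})
theorem2p3 = (λ N _ → zeckendorf-below-F (suc N) N (n<F[1+n] N)) , probability
  where
  probability : ∀ n .{{_ : NonZero n}} (k : ℕ) →
    Pr [ F n , F (suc n) ⟩ {{interval-nonZero n}} (hasSummands? (suc k))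
    ≡ ((+ ((n ∸ 1 ∸ k) C k)) / F (n ∸ 1)) {{F-nonZero (n ∸ 1)}}
  -- Numerators and denominators agree separately, so no fraction has to be reduced.
  probability (suc n) k =
    /-cong {{interval-nonZero (suc n)}} {{F-nonZero n}}
      (cong +_ (trans (count-interval-suc n k) (count-below-F n k)))
      (length-interval (suc n))
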